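{- Each of the following three graph classes contains a graph that is not a pairwise compatibility graph: (i) disk graphs, (ii) grid intersection graphs, (iii) circular arc graphs. In other words, none of these three classes is contained in the class PCG.
   Context: All graphs are finite and simple. A graph $G=(V,E)$ is a pairwise compatibility graph (PCG) if there exist a tree $T$ with non-negative real edge weights, whose set of leaves is exactly $V$, and two non-negative real numbers $d_{min}\le d_{max}$ such that for all distinct $u,v\in V$, $(u,v)\in E$ if and only if $d_{min}\le d_T(u,v)\le d_{max}$, where $d_T(u,v)$ is the sum of the weights of the edges on the unique path from $u$ to $v$ in $T$. A disk graph is the intersection graph of a family of disks in the plane. A grid intersection graph is the intersection graph of a family of horizontal and vertical line segments in the plane. A circular arc graph is the intersection graph of a family of arcs of a circle. -}

module Defs where

open import Data.Fin.Base using (Fin)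
open import Data.Integer.Base using (ℤ)
open import Data.List.Base using (List; []; _∷_)
open import Data.List.Relation.Unary.Unique.Propositional using (Unique)
open import Data.Nat.Base as ℕ using (ℕ)
import Data.Nat.Properties as ℕₚ
open import Data.Product.Base using (∃-syntax; Σ-syntax; _×_; _,_)
open import Data.Rational.Base as ℚ using (ℚ; 0ℚ; 1ℚ)
import Data.Rational.Properties as ℚₚ
open import Data.Rational.Solver using (module +-*-Solver)
open import Function.Base using (const)
open import Function.Bundles using (_⇔_)
open import Function.Definitions using (Injective)
open import Relation.Binary.Core using (Rel)
open import Relation.Binary.Definitions using (Decidable; Symmetric; Irreflexive)
open import Relation.Binary.PropositionalEquality
  using (_≡_; _≢_; refl; cong; cong₂)
open import Relation.Unary using (Pred; _≬_)
open import Level using (0ℓ)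

-- Cauchy sequences of rationals, with no quotient: equality of reals is
-- the relation _≈ᴿ_ below.
IsCauchy : (ℕ → ℚ) → Set
IsCauchy s = ∀ ε → 0ℚ ℚ.< ε →
  ∃[ N ] (∀ m n → N ℕ.≤ m → N ℕ.≤ n → ℚ.∣ s m ℚ.- s n ∣ ℚ.≤ ε)

record ℝ : Set where
  constructor mkℝ
  field
    seq    : ℕ → ℚ
    cauchy : IsCauchy seq

open ℝ

infix 4 _≤ᴿ_ _<ᴿ_ _≈ᴿ_

_≤ᴿ_ : Rel ℝ 0ℓ
x ≤ᴿ y = ∀ ε → 0ℚ ℚ.< ε →
  ∃[ N ] (∀ n → N ℕ.≤ n → seq x n ℚ.≤ seq y n ℚ.+ ε)

_<ᴿ_ : Rel ℝ 0ℓ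
x <ᴿ y = ∃[ ε ] 0ℚ ℚ.< ε ×
  ∃[ N ] (∀ n → N ℕ.≤ n → seq x n ℚ.+ ε ℚ.≤ seq y n)

_≈ᴿ_ : Rel ℝ 0ℓ
x ≈ᴿ y = x ≤ᴿ y × y ≤ᴿ x

module _ where
  open +-*-Solver

  +-split : ∀ a b c d → (a ℚ.+ b) ℚ.- (c ℚ.+ d) ≡ (a ℚ.- c) ℚ.+ (b ℚ.- d)
  +-split = solve 4 (λ a b c d →
    ((a :+ b) :- (c :+ d)) := ((a :- c) :+ (b :- d))) refl

  *-split : ∀ a b c d →
    (a ℚ.* b) ℚ.- (c ℚ.* d) ≡ (a ℚ.* (b ℚ.- d)) ℚ.+ (d ℚ.* (a ℚ.- c))
  *-split = solve 4 (λ a b c d →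
    ((a :* b) :- (c :* d)) := ((a :* (b :- d)) :+ (d :* (a :- c)))) refl

  neg-split : ∀ a b → (ℚ.- a) ℚ.- (ℚ.- b) ≡ ℚ.- (a ℚ.- b)
  neg-split = solve 2 (λ a b → ((:- a) :- (:- b)) := (:- (a :- b))) refl

  add-sub : ∀ a b → a ≡ (a ℚ.- b) ℚ.+ b
  add-sub = solve 2 (λ a b → a := ((a :- b) :+ b)) refl

module _ where
  open ℚₚ.≤-Reasoning

  divide : ∀ D ε → 0ℚ ℚ.< D → 0ℚ ℚ.< ε → ∃[ δ ] 0ℚ ℚ.< δ × D ℚ.* δ ≡ ε
  divide D ε 0<D 0<ε = δ , 0<δ , Dδ≡ε
    where
    instance
      D-pos : ℚ.Positive D
      D-pos = ℚ.positive 0<D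
      ε-pos : ℚ.Positive ε
      ε-pos = ℚ.positive 0<ε
      D-nz : ℚ.NonZero D
      D-nz = ℚₚ.pos⇒nonZero D
      1/D-pos : ℚ.Positive (ℚ.1/ D)
      1/D-pos = ℚₚ.1/pos⇒pos D

    δ : ℚ
    δ = ℚ.1/ D ℚ.* ε

    0<δ : 0ℚ ℚ.< δ
    0<δ = ℚₚ.positive⁻¹ δ {{ℚₚ.pos*pos⇒pos (ℚ.1/ D) ε}}

    Dδ≡ε : D ℚ.* δ ≡ ε
    Dδ≡ε = begin-equality
      D ℚ.* (ℚ.1/ D ℚ.* ε) ≡⟨ ℚₚ.*-assoc D (ℚ.1/ D) ε ⟨
      D ℚ.* ℚ.1/ D ℚ.* ε   ≡⟨ cong (ℚ._* ε) (ℚₚ.*-inverseʳ D) ⟩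
      1ℚ ℚ.* ε             ≡⟨ ℚₚ.*-identityˡ ε ⟩
      ε                    ∎

  0<1ℚ : 0ℚ ℚ.< 1ℚ
  0<1ℚ = ℚₚ.positive⁻¹ 1ℚ

  const-isCauchy : ∀ q → IsCauchy (const q)
  const-isCauchy q ε 0<ε = 0 , λ _ _ _ _ → begin
    ℚ.∣ q ℚ.- q ∣ ≡⟨ cong ℚ.∣_∣ (ℚₚ.+-inverseʳ q) ⟩
    0ℚ            ≤⟨ ℚₚ.<⇒≤ 0<ε ⟩
    ε             ∎

  +-isCauchy : ∀ s t → IsCauchy s → IsCauchy t →
               IsCauchy (λ n → s n ℚ.+ t n)
  +-isCauchy s t cs ct ε 0<ε =
    let δ , 0<δ , 2δ≡ε = divide (1ℚ ℚ.+ 1ℚ) ε (ℚₚ.+-mono-< 0<1ℚ 0<1ℚ) 0<ε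
        N , p = cs δ 0<δ
        M , q = ct δ 0<δ
    in N ℕ.⊔ M , λ m n hm hn → begin
      ℚ.∣ (s m ℚ.+ t m) ℚ.- (s n ℚ.+ t n) ∣
        ≡⟨ cong ℚ.∣_∣ (+-split (s m) (t m) (s n) (t n)) ⟩
      ℚ.∣ (s m ℚ.- s n) ℚ.+ (t m ℚ.- t n) ∣
        ≤⟨ ℚₚ.∣p+q∣≤∣p∣+∣q∣ (s m ℚ.- s n) (t m ℚ.- t n) ⟩
      ℚ.∣ s m ℚ.- s n ∣ ℚ.+ ℚ.∣ t m ℚ.- t n ∣
        ≤⟨ ℚₚ.+-mono-≤
             (p m n (ℕₚ.m⊔n≤o⇒m≤o N M hm) (ℕₚ.m⊔n≤o⇒m≤o N M hn))
             (q m n (ℕₚ.m⊔n≤o⇒n≤o N M hm) (ℕₚ.m⊔n≤o⇒n≤o N M hn)) ⟩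
      δ ℚ.+ δ
        ≡⟨ cong₂ ℚ._+_ (ℚₚ.*-identityˡ δ) (ℚₚ.*-identityˡ δ) ⟨
      1ℚ ℚ.* δ ℚ.+ 1ℚ ℚ.* δ
        ≡⟨ ℚₚ.*-distribʳ-+ δ 1ℚ 1ℚ ⟨
      (1ℚ ℚ.+ 1ℚ) ℚ.* δ
        ≡⟨ 2δ≡ε ⟩
      ε ∎

  neg-isCauchy : ∀ s → IsCauchy s → IsCauchy (λ n → ℚ.- s n)
  neg-isCauchy s cs ε 0<ε =
    let N , p = cs ε 0<ε
    in N , λ m n hm hn → begin
      ℚ.∣ (ℚ.- s m) ℚ.- (ℚ.- s n) ∣ ≡⟨ cong ℚ.∣_∣ (neg-split (s m) (s n)) ⟩
      ℚ.∣ ℚ.- (s m ℚ.- s n) ∣       ≡⟨ ℚₚ.∣-p∣≡∣p∣ (s m ℚ.- s n) ⟩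
      ℚ.∣ s m ℚ.- s n ∣             ≤⟨ p m n hm hn ⟩
      ε                             ∎

  eventuallyBounded : ∀ s → IsCauchy s →
    ∃[ B ] 0ℚ ℚ.< B × ∃[ N ] (∀ n → N ℕ.≤ n → ℚ.∣ s n ∣ ℚ.≤ B)
  eventuallyBounded s cs =
    let N , p = cs 1ℚ 0<1ℚ
    in 1ℚ ℚ.+ ℚ.∣ s N ∣
     , ℚₚ.+-mono-<-≤ 0<1ℚ (ℚₚ.0≤∣p∣ (s N))
     , N , λ n hn → begin
      ℚ.∣ s n ∣
        ≡⟨ cong ℚ.∣_∣ (add-sub (s n) (s N)) ⟩
      ℚ.∣ (s n ℚ.- s N) ℚ.+ s N ∣
        ≤⟨ ℚₚ.∣p+q∣≤∣p∣+∣q∣ (s n ℚ.- s N) (s N) ⟩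
      ℚ.∣ s n ℚ.- s N ∣ ℚ.+ ℚ.∣ s N ∣
        ≤⟨ ℚₚ.+-monoˡ-≤ ℚ.∣ s N ∣ (p n N hn ℕₚ.≤-refl) ⟩
      1ℚ ℚ.+ ℚ.∣ s N ∣ ∎

  *-mono-≤-abs : ∀ a b {B δ} → 0ℚ ℚ.< B →
    ℚ.∣ a ∣ ℚ.≤ B → ℚ.∣ b ∣ ℚ.≤ δ → ℚ.∣ a ℚ.* b ∣ ℚ.≤ B ℚ.* δ
  *-mono-≤-abs a b {B} {δ} 0<B p q = begin
    ℚ.∣ a ℚ.* b ∣
      ≡⟨ ℚₚ.∣p*q∣≡∣p∣*∣q∣ a b ⟩
    ℚ.∣ a ∣ ℚ.* ℚ.∣ b ∣
      ≤⟨ ℚₚ.*-monoʳ-≤-nonNeg ℚ.∣ b ∣ {{ℚ.nonNegative (ℚₚ.0≤∣p∣ b)}} p ⟩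
    B ℚ.* ℚ.∣ b ∣
      ≤⟨ ℚₚ.*-monoˡ-≤-nonNeg B {{ℚ.nonNegative (ℚₚ.<⇒≤ 0<B)}} q ⟩
    B ℚ.* δ ∎

  *-isCauchy : ∀ s t → IsCauchy s → IsCauchy t →
               IsCauchy (λ n → s n ℚ.* t n)
  *-isCauchy s t cs ct ε 0<ε =
    let B , 0<B , K , b = eventuallyBounded s cs
        C , 0<C , L , c = eventuallyBounded t ct
        δ , 0<δ , Dδ≡ε = divide (B ℚ.+ C) ε (ℚₚ.+-mono-< 0<B 0<C) 0<ε
        N , p = cs δ 0<δ
        M , q = ct δ 0<δ
    in (K ℕ.⊔ L) ℕ.⊔ (N ℕ.⊔ M) , λ m n hm hn →
    let KL≤m = ℕₚ.m⊔n≤o⇒m≤o (K ℕ.⊔ L) (N ℕ.⊔ M) hm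
        NM≤m = ℕₚ.m⊔n≤o⇒n≤o (K ℕ.⊔ L) (N ℕ.⊔ M) hm
        KL≤n = ℕₚ.m⊔n≤o⇒m≤o (K ℕ.⊔ L) (N ℕ.⊔ M) hn
        NM≤n = ℕₚ.m⊔n≤o⇒n≤o (K ℕ.⊔ L) (N ℕ.⊔ M) hn
    in begin
      ℚ.∣ s m ℚ.* t m ℚ.- s n ℚ.* t n ∣
        ≡⟨ cong ℚ.∣_∣ (*-split (s m) (t m) (s n) (t n)) ⟩
      ℚ.∣ s m ℚ.* (t m ℚ.- t n) ℚ.+ t n ℚ.* (s m ℚ.- s n) ∣
        ≤⟨ ℚₚ.∣p+q∣≤∣p∣+∣q∣ (s m ℚ.* (t m ℚ.- t n)) (t n ℚ.* (s m ℚ.- s n)) ⟩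
      ℚ.∣ s m ℚ.* (t m ℚ.- t n) ∣ ℚ.+ ℚ.∣ t n ℚ.* (s m ℚ.- s n) ∣
        ≤⟨ ℚₚ.+-mono-≤
             (*-mono-≤-abs (s m) (t m ℚ.- t n) 0<B
               (b m (ℕₚ.m⊔n≤o⇒m≤o K L KL≤m))
               (q m n (ℕₚ.m⊔n≤o⇒n≤o N M NM≤m) (ℕₚ.m⊔n≤o⇒n≤o N M NM≤n)))
             (*-mono-≤-abs (t n) (s m ℚ.- s n) 0<C
               (c n (ℕₚ.m⊔n≤o⇒n≤o K L KL≤n))
               (p m n (ℕₚ.m⊔n≤o⇒m≤o N M NM≤m) (ℕₚ.m⊔n≤o⇒m≤o N M NM≤n))) ⟩
      B ℚ.* δ ℚ.+ C ℚ.* δ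
        ≡⟨ ℚₚ.*-distribʳ-+ δ B C ⟨
      (B ℚ.+ C) ℚ.* δ
        ≡⟨ Dδ≡ε ⟩
      ε ∎

infixl 6 _+ᴿ_ _-ᴿ_
infixl 7 _*ᴿ_
infix  8 -ᴿ_

fromℚ : ℚ → ℝ
fromℚ q = mkℝ (const q) (const-isCauchy q)

fromℤ : ℤ → ℝ
fromℤ k = fromℚ (k ℚ./ 1)

0ᴿ 1ᴿ : ℝ
0ᴿ = fromℚ 0ℚ
1ᴿ = fromℚ 1ℚ

_+ᴿ_ : ℝ → ℝ → ℝ
x +ᴿ y = mkℝ (λ n → seq x n ℚ.+ seq y n)
              (+-isCauchy (seq x) (seq y) (cauchy x) (cauchy y))

_*ᴿ_ : ℝ → ℝ → ℝ
x *ᴿ y = mkℝ (λ n → seq x n ℚ.* seq y n)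
              (*-isCauchy (seq x) (seq y) (cauchy x) (cauchy y))

-ᴿ_ : ℝ → ℝ
-ᴿ x = mkℝ (λ n → ℚ.- seq x n) (neg-isCauchy (seq x) (cauchy x))

_-ᴿ_ : ℝ → ℝ → ℝ
x -ᴿ y = x +ᴿ (-ᴿ y)

record Graph (n : ℕ) : Set₁ where
  infix 4 _~_
  field
    _~_      : Rel (Fin n) 0ℓ
    ~-sym    : Symmetric _~_
    ~-irrefl : Irreflexive _≡_ _~_
    _~?_     : Decidable _~_

module _ {n : ℕ} (G : Graph n) where
  open Graph G

  infixr 5 _∷_

  data Walk : Rel (Fin n) 0ℓ where
    []  : ∀ {u} → Walk u u
    _∷_ : ∀ {u v w} → u ~ v → Walk v w → Walk u w

  vertices : ∀ {u v} → Walk u v → List (Fin n)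
  vertices {u} []      = u ∷ []
  vertices {u} (_ ∷ p) = u ∷ vertices p

  IsPath : ∀ {u v} → Walk u v → Set
  IsPath p = Unique (vertices p)

  record IsTree : Set where
    field
      path   : ∀ u v → Walk u v
      isPath : ∀ u v → IsPath (path u v)
      unique : ∀ {u v} (p q : Walk u v) → IsPath p → IsPath q →
               vertices p ≡ vertices q

  -- At most one neighbour, rather than exactly one, so that the vertex of
  -- a one-vertex tree is a leaf (otherwise K₁ would fail to be a PCG).
  IsLeaf : Pred (Fin n) 0ℓ
  IsLeaf x = ∀ {y z} → x ~ y → x ~ z → y ≡ z

  length : (Fin n → Fin n → ℝ) → ∀ {u v} → Walk u v → ℝ
  length w []                = 0ᴿ
  length w (_∷_ {u} {v} _ p) = w u v +ᴿ length w p

record WeightedTree (m : ℕ) : Set₁ where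
  field
    graph  : Graph m
    isTree : IsTree graph

  open Graph graph public
  open IsTree isTree public

  -- Only the values at adjacent pairs matter.
  field
    weight     : Fin m → Fin m → ℝ
    weight-sym : ∀ {x y} → x ~ y → weight x y ≈ᴿ weight y x
    weight-≥0  : ∀ {x y} → x ~ y → 0ᴿ ≤ᴿ weight x y

  dist : Fin m → Fin m → ℝ
  dist x y = length graph weight (path x y)

record PCG {n : ℕ} (G : Graph n) : Set₁ where
  open Graph G
  field
    {m}       : ℕ
    tree      : WeightedTree m
  open WeightedTree tree using (graph; dist)
  field
    -- identifies the vertices of G with the leaves of the tree
    leaf      : Fin n → Fin m
    leaf-inj  : Injective _≡_ _≡_ leaf
    leaf-onto : ∀ x → IsLeaf graph x ⇔ (∃[ u ] leaf u ≡ x)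
    dmin dmax : ℝ
    0≤dmin    : 0ᴿ ≤ᴿ dmin
    dmin≤dmax : dmin ≤ᴿ dmax
    adjacent  : ∀ u v → u ≢ v →
      u ~ v ⇔ (dmin ≤ᴿ dist (leaf u) (leaf v) × dist (leaf u) (leaf v) ≤ᴿ dmax)

IsIntersectionGraph : {P : Set} {n : ℕ} → Graph n → (Fin n → Pred P 0ℓ) → Set
IsIntersectionGraph G S = ∀ u v → u ≢ v → u ~ v ⇔ (S u ≬ S v)
  where open Graph G

ℝ² : Set
ℝ² = ℝ × ℝ

record Disk : Set where
  field
    centre-x centre-y radius : ℝ
    radius>0 : 0ᴿ <ᴿ radius

⟦_⟧ᴰ : Disk → Pred ℝ² 0ℓ
⟦ D ⟧ᴰ (x , y) =
  (x -ᴿ centre-x) *ᴿ (x -ᴿ centre-x) +ᴿ (y -ᴿ centre-y) *ᴿ (y -ᴿ centre-y)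
    ≤ᴿ radius *ᴿ radius
  where open Disk D

IsDiskGraph : {n : ℕ} → Graph n → Set
IsDiskGraph {n} G =
  Σ[ D ∈ (Fin n → Disk) ] IsIntersectionGraph G (λ u → ⟦ D u ⟧ᴰ)

data Segment : Set where
  horizontal : (x₁ x₂ y : ℝ) → x₁ <ᴿ x₂ → Segment
  vertical   : (x y₁ y₂ : ℝ) → y₁ <ᴿ y₂ → Segment

⟦_⟧ˢ : Segment → Pred ℝ² 0ℓ
⟦ horizontal x₁ x₂ y _ ⟧ˢ (p , q) = (x₁ ≤ᴿ p × p ≤ᴿ x₂) × q ≈ᴿ y
⟦ vertical   x y₁ y₂ _ ⟧ˢ (p , q) = p ≈ᴿ x × (y₁ ≤ᴿ q × q ≤ᴿ y₂)

IsGridIntersectionGraph : {n : ℕ} → Graph n → Set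
IsGridIntersectionGraph {n} G =
  Σ[ S ∈ (Fin n → Segment) ] IsIntersectionGraph G (λ u → ⟦ S u ⟧ˢ)

-- The circle is ℝ/ℤ: a real t stands for the point at angle 2πt.  An arc
-- runs counterclockwise from start to end, through less than a full turn.
record Arc : Set where
  field
    start end   : ℝ
    start<end   : start <ᴿ end
    end<start+1 : end <ᴿ start +ᴿ 1ᴿ

⟦_⟧ᴬ : Arc → Pred ℝ 0ℓ
⟦ A ⟧ᴬ t = ∃[ k ] start ≤ᴿ t +ᴿ fromℤ k × t +ᴿ fromℤ k ≤ᴿ end
  where open Arc A

IsCircularArcGraph : {n : ℕ} → Graph n → Set
IsCircularArcGraph {n} G =
  Σ[ A ∈ (Fin n → Arc) ] IsIntersectionGraph G (λ u → ⟦ A u ⟧ᴬ)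

{-# OPTIONS --safe #-}

-- One graph serves for all three classes: the 4-cycle with every vertex
-- doubled, that is, the join of two copies of 2K₂.  It is the intersection
-- graph of the doubled sides of a square, of four doubled quarter arcs of a
-- circle, and of four doubled disks arranged in a ring.
--
-- It is not a PCG by the four-point condition on tree distances: among
-- ab + cd, ac + bd and ad + bc, none exceeds both others.  Call a nonadjacent
-- pair large if its distance exceeds dmax, and small if it is below dmin.  If
-- both copies of 2K₂ had a large pair, say aa′ and bb′, then aa′ + bb′ would
-- exceed ab + a′b′ and ab′ + a′b, which are sums of edges.  So all nonadjacent
-- pairs of one copy are small; then the sum of its two edges exceeds the sums
-- along the other two pairings of its vertices.
module Submission where

open import Defs
open import Data.Fin.Base using (Fin; toℕ; quotient; combine)
open import Data.Fin.Patterns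
open import Data.Fin.Properties using (_≟_; all?)
open import Data.Integer.Base as ℤ using (ℤ; 0ℤ; 1ℤ; -1ℤ; +_)
import Data.Integer.Properties as ℤₚ
open import Data.List.Base using (List; []; _∷_)
import Data.List.Membership.DecPropositional as DecMembership
open import Data.List.Membership.Propositional using (_∈_; _∉_)
open import Data.List.Relation.Binary.Subset.Propositional using (_⊆_)
open import Data.List.Relation.Unary.All.Properties using (¬Any⇒All¬)
open import Data.List.Relation.Unary.All using ([])
open import Data.List.Relation.Unary.AllPairs using ([]; _∷_)
open import Data.List.Relation.Unary.Any using (here; there)
open import Data.Nat.Base as ℕ using (ℕ; suc)
import Data.Nat.Properties as ℕₚ
open import Data.Product using (∃-syntax; _×_)
open import Data.Product.Base using (Σ-syntax; _,_; proj₁; proj₂)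
open import Data.Rational.Base as ℚ using (ℚ; 0ℚ; 1ℚ)
import Data.Rational.Properties as ℚₚ
open import Data.Rational.Solver using (module +-*-Solver)
open import Data.Rational.Unnormalised.Base as ℚᵘ using (mkℚᵘ; *≤*; *≡*)
import Data.Rational.Unnormalised.Properties as ℚᵘₚ
open import Data.Sum.Base as Sum using (_⊎_; inj₁; inj₂)
open import Function.Base using (_∘_; id)
open import Function.Bundles using (mk⇔; Equivalence)
open import Level using (0ℓ)
open import Relation.Binary.Bundles using (Preorder)
open import Relation.Binary.PropositionalEquality
  using (_≡_; _≢_; refl; sym; trans; cong; cong₂; subst; ≢-sym)
open import Relation.Nullary using (¬_)
open import Relation.Nullary.Decidable
  using (Dec; yes; no; ¬?; _×-dec_; _⊎-dec_; _→-dec_; from-yes; from-no)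
open import Relation.Nullary.Negation using (contradiction)
open import Relation.Unary using (Pred; _≬_)

open ℝ
open Equivalence using (to; from)
open +-*-Solver using (solve; _:+_; _:*_; _:-_; :-_; _:=_; con)

-- Reals

halve : ∀ ε → 0ℚ ℚ.< ε → ∃[ δ ] 0ℚ ℚ.< δ × δ ℚ.+ δ ≡ ε
halve ε 0<ε =
  let δ , 0<δ , 2δ≡ε = divide (1ℚ ℚ.+ 1ℚ) ε (ℚₚ.+-mono-< 0<1ℚ 0<1ℚ) 0<ε
  in δ , 0<δ , trans (solve 1 (λ d → d :+ d := (con 1ℚ :+ con 1ℚ) :* d) refl δ) 2δ≡ε

p≤p+ε : ∀ p {ε} → 0ℚ ℚ.< ε → p ℚ.≤ p ℚ.+ ε
p≤p+ε p {ε} 0<ε = begin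
  p             ≡⟨ ℚₚ.+-identityʳ p ⟨
  p ℚ.+ 0ℚ      ≤⟨ ℚₚ.+-monoʳ-≤ p (ℚₚ.<⇒≤ 0<ε) ⟩
  p ℚ.+ ε       ∎
  where open ℚₚ.≤-Reasoning

p≤∣p∣ : ∀ p → p ℚ.≤ ℚ.∣ p ∣
p≤∣p∣ p with ℚₚ.≤-total 0ℚ p
... | inj₁ 0≤p = ℚₚ.≤-reflexive (sym (ℚₚ.0≤p⇒∣p∣≡p 0≤p))
... | inj₂ p≤0 = ℚₚ.≤-trans p≤0 (ℚₚ.0≤∣p∣ p)

+-cancelʳ-≤ : ∀ r {p q} → p ℚ.+ r ℚ.≤ q ℚ.+ r → p ℚ.≤ q
+-cancelʳ-≤ r p+r≤q+r = ℚₚ.≮⇒≥ λ q<p →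
  ℚₚ.<-irrefl refl (ℚₚ.<-≤-trans (ℚₚ.+-monoˡ-< r q<p) p+r≤q+r)

-- The one-sided form of the Cauchy condition, free of absolute values.
cauchy-≤ : ∀ x δ → 0ℚ ℚ.< δ →
  ∃[ N ] (∀ m n → N ℕ.≤ m → N ℕ.≤ n → seq x m ℚ.≤ seq x n ℚ.+ δ)
cauchy-≤ x δ 0<δ =
  let N , p = cauchy x δ 0<δ
  in N , λ m n hm hn → begin
    seq x m                              ≡⟨ add-sub (seq x m) (seq x n) ⟩
    (seq x m ℚ.- seq x n) ℚ.+ seq x n
      ≤⟨ ℚₚ.+-monoˡ-≤ (seq x n) (ℚₚ.≤-trans (p≤∣p∣ (seq x m ℚ.- seq x n)) (p m n hm hn)) ⟩
    δ ℚ.+ seq x n                        ≡⟨ ℚₚ.+-comm δ (seq x n) ⟩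
    seq x n ℚ.+ δ                        ∎
  where open ℚₚ.≤-Reasoning

infix 4 _≲_ _≃_

-- A wrapper around _≤ᴿ_ from which, unlike from its unfolding, Agda can
-- infer the two reals.
record _≲_ (x y : ℝ) : Set where
  constructor wrap
  field unwrap : x ≤ᴿ y

open _≲_ public

_≃_ : ℝ → ℝ → Set
x ≃ y = x ≲ y × y ≲ x

pointwise-≲ : ∀ {x y} → (∀ n → seq x n ℚ.≤ seq y n) → x ≲ y
pointwise-≲ {x} {y} x≤y = wrap λ ε 0<ε →
  0 , λ n _ → ℚₚ.≤-trans (x≤y n) (p≤p+ε (seq y n) 0<ε)

pointwise-≃ : ∀ {x y} → (∀ n → seq x n ≡ seq y n) → x ≃ y
pointwise-≃ x≡y =
    pointwise-≲ (λ n → ℚₚ.≤-reflexive (x≡y n))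
  , pointwise-≲ (λ n → ℚₚ.≤-reflexive (sym (x≡y n)))

≲-refl : ∀ {x} → x ≲ x
≲-refl = pointwise-≲ λ _ → ℚₚ.≤-refl

≃-refl : ∀ {x} → x ≃ x
≃-refl = ≲-refl , ≲-refl

≃-sym : ∀ {x y} → x ≃ y → y ≃ x
≃-sym (x≲y , y≲x) = y≲x , x≲y

≲-trans : ∀ {x y z} → x ≲ y → y ≲ z → x ≲ z
≲-trans {x} {y} {z} x≲y y≲z = wrap λ ε 0<ε →
  let δ , 0<δ , δ+δ≡ε = halve ε 0<ε
      N , p = unwrap x≲y δ 0<δ
      M , q = unwrap y≲z δ 0<δ
  in N ℕ.⊔ M , λ n hn → begin
    seq x n                   ≤⟨ p n (ℕₚ.m⊔n≤o⇒m≤o N M hn) ⟩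
    seq y n ℚ.+ δ             ≤⟨ ℚₚ.+-monoˡ-≤ δ (q n (ℕₚ.m⊔n≤o⇒n≤o N M hn)) ⟩
    (seq z n ℚ.+ δ) ℚ.+ δ     ≡⟨ ℚₚ.+-assoc (seq z n) δ δ ⟩
    seq z n ℚ.+ (δ ℚ.+ δ)     ≡⟨ cong (seq z n ℚ.+_) δ+δ≡ε ⟩
    seq z n ℚ.+ ε             ∎
  where open ℚₚ.≤-Reasoning

≲-preorder : Preorder 0ℓ 0ℓ 0ℓ
≲-preorder = record
  { _≈_        = _≃_
  ; _≲_        = _≲_
  ; isPreorder = record
    { isEquivalence = record
      { refl  = ≃-refl
      ; sym   = ≃-sym
      ; trans = λ (x≲y , y≲x) (y≲z , z≲y) → ≲-trans x≲y y≲z , ≲-trans z≲y y≲x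
      }
    ; reflexive = proj₁
    ; trans     = ≲-trans
    }
  }

module ≲-Reasoning where
  open import Relation.Binary.Reasoning.Preorder ≲-preorder public

infixl 6 _⊕_

-- Addition, opaque so that sums are compared as they are written instead of
-- through the Cauchy proofs they unfold to.
opaque
  _⊕_ : ℝ → ℝ → ℝ
  x ⊕ y = x +ᴿ y

  +ᴿ≡⊕ : ∀ x y → x +ᴿ y ≡ x ⊕ y
  +ᴿ≡⊕ x y = refl

  ⊕-mono : ∀ {x y u v} → x ≲ y → u ≲ v → x ⊕ u ≲ y ⊕ v
  ⊕-mono {x} {y} {u} {v} x≲y u≲v = wrap λ ε 0<ε →
    let δ , 0<δ , δ+δ≡ε = halve ε 0<ε
        N , p = unwrap x≲y δ 0<δ
        M , q = unwrap u≲v δ 0<δ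
    in N ℕ.⊔ M , λ n hn → begin
      seq x n ℚ.+ seq u n
        ≤⟨ ℚₚ.+-mono-≤ (p n (ℕₚ.m⊔n≤o⇒m≤o N M hn)) (q n (ℕₚ.m⊔n≤o⇒n≤o N M hn)) ⟩
      (seq y n ℚ.+ δ) ℚ.+ (seq v n ℚ.+ δ)
        ≡⟨ solve 3 (λ y v d → (y :+ d) :+ (v :+ d) := (y :+ v) :+ (d :+ d))
             refl (seq y n) (seq v n) δ ⟩
      (seq y n ℚ.+ seq v n) ℚ.+ (δ ℚ.+ δ)
        ≡⟨ cong (seq y n ℚ.+ seq v n ℚ.+_) δ+δ≡ε ⟩
      (seq y n ℚ.+ seq v n) ℚ.+ ε ∎
    where open ℚₚ.≤-Reasoning

  ⊕-cong : ∀ {x y u v} → x ≃ y → u ≃ v → x ⊕ u ≃ y ⊕ v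
  ⊕-cong (x≲y , y≲x) (u≲v , v≲u) = ⊕-mono x≲y u≲v , ⊕-mono y≲x v≲u

  ⊕-comm : ∀ x y → x ⊕ y ≃ y ⊕ x
  ⊕-comm x y = pointwise-≃ λ n → ℚₚ.+-comm (seq x n) (seq y n)

  ⊕-assoc : ∀ x y z → (x ⊕ y) ⊕ z ≃ x ⊕ (y ⊕ z)
  ⊕-assoc x y z = pointwise-≃ λ n → ℚₚ.+-assoc (seq x n) (seq y n) (seq z n)

  ⊕-identityˡ : ∀ x → 0ᴿ ⊕ x ≃ x
  ⊕-identityˡ x = pointwise-≃ λ n → ℚₚ.+-identityˡ (seq x n)

  ⊕-interchange : ∀ x y u v → (x ⊕ y) ⊕ (u ⊕ v) ≃ (x ⊕ u) ⊕ (y ⊕ v)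
  ⊕-interchange x y u v = pointwise-≃ λ n →
    solve 4 (λ x y u v → (x :+ y) :+ (u :+ v) := (x :+ u) :+ (y :+ v)) refl
      (seq x n) (seq y n) (seq u n) (seq v n)

  ⊕-cancelʳ : ∀ z {x y} → x ⊕ z ≲ y ⊕ z → x ≲ y
  ⊕-cancelʳ z {x} {y} x+z≲y+z = wrap λ ε 0<ε →
    let N , p = unwrap x+z≲y+z ε 0<ε
    in N , λ n hn → +-cancelʳ-≤ (seq z n) (begin
      seq x n ℚ.+ seq z n           ≤⟨ p n hn ⟩
      (seq y n ℚ.+ seq z n) ℚ.+ ε
        ≡⟨ solve 3 (λ y z e → (y :+ z) :+ e := (y :+ e) :+ z) refl (seq y n) (seq z n) ε ⟩
      (seq y n ℚ.+ ε) ℚ.+ seq z n   ∎)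
    where open ℚₚ.≤-Reasoning

-- Comparing the two sequences at one late index decides either the claim
-- up to ε, or y ≤ x outright.
≴⇒≳ : ∀ {x y} → ¬ (y ≲ x) → x ≲ y
≴⇒≳ {x} {y} y≴x = wrap λ ε 0<ε →
  let γ , 0<γ , γ+γ≡ε = halve ε 0<ε
      δ , 0<δ , δ+δ≡γ = halve γ 0<γ
      N , p = cauchy-≤ x δ 0<δ
      M , q = cauchy-≤ y δ 0<δ
  in N ℕ.⊔ M , close γ+γ≡ε δ+δ≡γ
    (λ m n hm hn → p m n (ℕₚ.m⊔n≤o⇒m≤o N M hm) (ℕₚ.m⊔n≤o⇒m≤o N M hn))
    (λ m n hm hn → q m n (ℕₚ.m⊔n≤o⇒n≤o N M hm) (ℕₚ.m⊔n≤o⇒n≤o N M hn))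
  where
  open ℚₚ.≤-Reasoning

  module _ {ε γ δ k} (γ+γ≡ε : γ ℚ.+ γ ≡ ε) (δ+δ≡γ : δ ℚ.+ δ ≡ γ)
    (x≈ : ∀ m n → k ℕ.≤ m → k ℕ.≤ n → seq x m ℚ.≤ seq x n ℚ.+ δ)
    (y≈ : ∀ m n → k ℕ.≤ m → k ℕ.≤ n → seq y m ℚ.≤ seq y n ℚ.+ δ) where

    -- The gap `γ` is `δ + δ` so that it absorbs one Cauchy error `δ` of each sequence.
    y≲x : seq y k ℚ.+ γ ℚ.≤ seq x k → y ≲ x
    y≲x yₖ+γ≤xₖ = wrap λ ε′ 0<ε′ → k , λ n hn → +-cancelʳ-≤ δ (begin
      seq y n ℚ.+ δ                      ≤⟨ ℚₚ.+-monoˡ-≤ δ (y≈ n k hn ℕₚ.≤-refl) ⟩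
      (seq y k ℚ.+ δ) ℚ.+ δ              ≡⟨ ℚₚ.+-assoc (seq y k) δ δ ⟩
      seq y k ℚ.+ (δ ℚ.+ δ)              ≡⟨ cong (seq y k ℚ.+_) δ+δ≡γ ⟩
      seq y k ℚ.+ γ                      ≤⟨ yₖ+γ≤xₖ ⟩
      seq x k                            ≤⟨ x≈ k n ℕₚ.≤-refl hn ⟩
      seq x n ℚ.+ δ                      ≤⟨ ℚₚ.+-monoˡ-≤ δ (p≤p+ε (seq x n) 0<ε′) ⟩
      (seq x n ℚ.+ ε′) ℚ.+ δ             ∎)

    close : ∀ n → k ℕ.≤ n → seq x n ℚ.≤ seq y n ℚ.+ ε
    close n hn = begin
      seq x n                            ≤⟨ x≈ n k hn ℕₚ.≤-refl ⟩
      seq x k ℚ.+ δ                      ≤⟨ ℚₚ.+-monoˡ-≤ δ xₖ≤yₖ+γ ⟩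
      (seq y k ℚ.+ γ) ℚ.+ δ
        ≤⟨ ℚₚ.+-monoˡ-≤ δ (ℚₚ.+-monoˡ-≤ γ (y≈ k n ℕₚ.≤-refl hn)) ⟩
      ((seq y n ℚ.+ δ) ℚ.+ γ) ℚ.+ δ
        ≡⟨ solve 3 (λ y d g → ((y :+ d) :+ g) :+ d := y :+ ((d :+ d) :+ g))
             refl (seq y n) δ γ ⟩
      seq y n ℚ.+ ((δ ℚ.+ δ) ℚ.+ γ)
        ≡⟨ cong (seq y n ℚ.+_) (trans (cong (ℚ._+ γ) δ+δ≡γ) γ+γ≡ε) ⟩
      seq y n ℚ.+ ε                      ∎
      where
      xₖ≤yₖ+γ : seq x k ℚ.≤ seq y k ℚ.+ γ
      xₖ≤yₖ+γ with ℚₚ.≤-total (seq x k) (seq y k ℚ.+ γ)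
      ... | inj₁ xₖ≤yₖ+γ = xₖ≤yₖ+γ
      ... | inj₂ yₖ+γ≤xₖ = contradiction (y≲x yₖ+γ≤xₖ) y≴x

-- Refutes a four-point alternative with `z = dmin`: `u`, `v` are small distances and `x`, `y`
-- distances of edges. By `≴⇒≳` the second negation gives `v ≲ z`, and cancelling `z` from
-- `z ⊕ z ≲ u ⊕ z` contradicts the first.
u,v≵z⇒u+v≵z+z : ∀ {z u v x y} → ¬ (z ≲ u) → ¬ (z ≲ v) →
                z ≲ x → z ≲ y → ¬ (x ⊕ y ≲ u ⊕ v)
u,v≵z⇒u+v≵z+z {z} {u} {v} {x} {y} z≴u z≴v z≲x z≲y x+y≲u+v = z≴u (⊕-cancelʳ z (begin
  z ⊕ z   ≲⟨ ⊕-mono z≲x z≲y ⟩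
  x ⊕ y   ≲⟨ x+y≲u+v ⟩
  u ⊕ v   ≲⟨ ⊕-mono (≲-refl {u}) (≴⇒≳ z≴v) ⟩
  u ⊕ z   ∎))
  where open ≲-Reasoning

-- The mirror image for `z = dmax`, with `u`, `v` large distances.
u,v≴z⇒u+v≴z+z : ∀ {z u v x y} → ¬ (u ≲ z) → ¬ (v ≲ z) →
                x ≲ z → y ≲ z → ¬ (u ⊕ v ≲ x ⊕ y)
u,v≴z⇒u+v≴z+z {z} {u} {v} {x} {y} u≴z v≴z x≲z y≲z u+v≲x+y = u≴z (⊕-cancelʳ z (begin
  u ⊕ z   ≲⟨ ⊕-mono (≲-refl {u}) (≴⇒≳ v≴z) ⟩
  u ⊕ v   ≲⟨ u+v≲x+y ⟩
  x ⊕ y   ≲⟨ ⊕-mono x≲z y≲z ⟩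
  z ⊕ z   ∎))
  where open ≲-Reasoning

-- At an index past both bounds, the slack `δ` of `y ≲ x` is only half the margin `ε` of `x <ᴿ y`.
<⇒≴ : ∀ {x y} → x <ᴿ y → ¬ (y ≲ x)
<⇒≴ {x} {y} (ε , 0<ε , N , p) y≲x =
  let δ , 0<δ , δ+δ≡ε = halve ε 0<ε
      M , q = unwrap y≲x δ 0<δ
      n = N ℕ.⊔ M
  in ℚₚ.<-irrefl refl (begin-strict
    seq y n                 ≤⟨ q n (ℕₚ.m≤n⊔m N M) ⟩
    seq x n ℚ.+ δ           ≡⟨ cong (seq x n ℚ.+_) (ℚₚ.+-identityʳ δ) ⟨
    seq x n ℚ.+ (δ ℚ.+ 0ℚ)  <⟨ ℚₚ.+-monoʳ-< (seq x n) (ℚₚ.+-monoʳ-< δ 0<δ) ⟩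
    seq x n ℚ.+ (δ ℚ.+ δ)   ≡⟨ cong (seq x n ℚ.+_) δ+δ≡ε ⟩
    seq x n ℚ.+ ε           ≤⟨ p n (ℕₚ.m≤m⊔n N M) ⟩
    seq y n                 ∎)
  where open ℚₚ.≤-Reasoning

fromℚ-mono : ∀ {p q} → p ℚ.≤ q → fromℚ p ≲ fromℚ q
fromℚ-mono p≤q = pointwise-≲ λ _ → p≤q

fromℚ-mono-< : ∀ {p q} → p ℚ.< q → fromℚ p <ᴿ fromℚ q
fromℚ-mono-< {p} {q} p<q =
    q ℚ.- p
  , subst (ℚ._< q ℚ.- p) (ℚₚ.+-inverseʳ p) (ℚₚ.+-monoˡ-< (ℚ.- p) p<q)
  , 0
  , λ _ _ → ℚₚ.≤-reflexive (solve 2 (λ p q → p :+ (q :- p) := q) refl p q)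

-- Walks, and distances in weighted trees

module WalkProperties {n} (G : Graph n) where
  open Graph G

  infixr 5 _++ʷ_

  _++ʷ_ : ∀ {u v w} → Walk G u v → Walk G v w → Walk G u w
  []      ++ʷ q = q
  (e ∷ p) ++ʷ q = e ∷ (p ++ʷ q)

  reverseʷ : ∀ {u v} → Walk G u v → Walk G v u
  reverseʷ []      = []
  reverseʷ (e ∷ p) = reverseʷ p ++ʷ (~-sym e ∷ [])

  head∈ : ∀ {u v} (p : Walk G u v) → u ∈ vertices G p
  head∈ []      = here refl
  head∈ (e ∷ p) = here refl

  ∈-++ʷ⁻ : ∀ {u v w x} (p : Walk G u v) (q : Walk G v w) →
           x ∈ vertices G (p ++ʷ q) → x ∈ vertices G p ⊎ x ∈ vertices G q
  ∈-++ʷ⁻ []      q x∈         = inj₂ x∈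
  ∈-++ʷ⁻ (e ∷ p) q (here x≡)  = inj₁ (here x≡)
  ∈-++ʷ⁻ (e ∷ p) q (there x∈) = Sum.map₁ there (∈-++ʷ⁻ p q x∈)

  ∈-++ʷ⁺ʳ : ∀ {u v w x} (p : Walk G u v) (q : Walk G v w) →
            x ∈ vertices G q → x ∈ vertices G (p ++ʷ q)
  ∈-++ʷ⁺ʳ []      q x∈ = x∈
  ∈-++ʷ⁺ʳ (e ∷ p) q x∈ = there (∈-++ʷ⁺ʳ p q x∈)

  ∈-reverseʷ⁻ : ∀ {u v x} (p : Walk G u v) →
                x ∈ vertices G (reverseʷ p) → x ∈ vertices G p
  ∈-reverseʷ⁻ []      x∈ = x∈
  ∈-reverseʷ⁻ (e ∷ p) x∈ with ∈-++ʷ⁻ (reverseʷ p) (~-sym e ∷ []) x∈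
  ... | inj₁ x∈p                = there (∈-reverseʷ⁻ p x∈p)
  ... | inj₂ (here refl)        = there (head∈ p)
  ... | inj₂ (there (here x≡u)) = here x≡u

  split : ∀ {u v x} (p : Walk G u v) → x ∈ vertices G p →
          Σ[ q ∈ Walk G u x ] Σ[ r ∈ Walk G x v ] p ≡ q ++ʷ r
  split []      (here refl) = [] , [] , refl
  split (e ∷ p) (here refl) = [] , e ∷ p , refl
  split (e ∷ p) (there x∈)  with q , r , refl ← split p x∈ = e ∷ q , r , refl

  suffix-isPath : ∀ {u v w} (p : Walk G u v) (q : Walk G v w) →
                  IsPath G (p ++ʷ q) → IsPath G q
  suffix-isPath []      q uniq       = uniq
  suffix-isPath (e ∷ p) q (_ ∷ uniq) = suffix-isPath p q uniq

  ∷-isPath : ∀ {u v w} (e : u ~ v) (p : Walk G v w) →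
             u ∉ vertices G p → IsPath G p → IsPath G (e ∷ p)
  ∷-isPath e p u∉p uniq = ¬Any⇒All¬ (vertices G p) u∉p ∷ uniq

module TreeProperties {m} (T : WeightedTree m) where
  open WeightedTree T
  open WalkProperties graph
  open DecMembership (_≟_ {m}) using (_∈?_)
  open ≲-Reasoning

  -- `length`, rebuilt with the opaque sum.
  ∣_∣ʷ : ∀ {u v} → Walk graph u v → ℝ
  ∣ [] ∣ʷ                = 0ᴿ
  ∣ _∷_ {u} {v} e p ∣ʷ   = weight u v ⊕ ∣ p ∣ʷ

  length≡∣_∣ʷ : ∀ {u v} (p : Walk graph u v) → length graph weight p ≡ ∣ p ∣ʷ
  length≡∣ [] ∣ʷ              = refl
  length≡∣ _∷_ {u} {v} e p ∣ʷ =
    trans (+ᴿ≡⊕ (weight u v) (length graph weight p)) (cong (weight u v ⊕_) length≡∣ p ∣ʷ)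

  length-≥0 : ∀ {u v} (p : Walk graph u v) → 0ᴿ ≲ ∣ p ∣ʷ
  length-≥0 []                = ≲-refl
  length-≥0 (_∷_ {u} {v} e p) = begin
    0ᴿ                     ≈⟨ ⊕-identityˡ 0ᴿ ⟨
    0ᴿ ⊕ 0ᴿ               ≲⟨ ⊕-mono (wrap (weight-≥0 e)) (length-≥0 p) ⟩
    weight u v ⊕ ∣ p ∣ʷ   ∎

  length-++ʷ : ∀ {u v w} (p : Walk graph u v) (q : Walk graph v w) →
               ∣ p ++ʷ q ∣ʷ ≃ ∣ p ∣ʷ ⊕ ∣ q ∣ʷ
  length-++ʷ []      q = ≃-sym (⊕-identityˡ ∣ q ∣ʷ)
  length-++ʷ (_∷_ {u} {v} e p) q = begin-equality
    weight u v ⊕ ∣ p ++ʷ q ∣ʷ          ≈⟨ ⊕-cong ≃-refl (length-++ʷ p q) ⟩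
    weight u v ⊕ (∣ p ∣ʷ ⊕ ∣ q ∣ʷ)    ≈⟨ ⊕-assoc (weight u v) ∣ p ∣ʷ ∣ q ∣ʷ ⟨
    (weight u v ⊕ ∣ p ∣ʷ) ⊕ ∣ q ∣ʷ    ∎

  length-reverseʷ : ∀ {u v} (p : Walk graph u v) → ∣ reverseʷ p ∣ʷ ≃ ∣ p ∣ʷ
  length-reverseʷ []                = ≃-refl
  length-reverseʷ (_∷_ {u} {v} e p) = begin-equality
    ∣ reverseʷ p ++ʷ (~-sym e ∷ []) ∣ʷ   ≈⟨ length-++ʷ (reverseʷ p) (~-sym e ∷ []) ⟩
    ∣ reverseʷ p ∣ʷ ⊕ (weight v u ⊕ 0ᴿ)
      ≈⟨ ⊕-cong (length-reverseʷ p) (≃-sym (⊕-comm 0ᴿ (weight v u))) ⟩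
    ∣ p ∣ʷ ⊕ (0ᴿ ⊕ weight v u)
      ≈⟨ ⊕-cong ≃-refl (⊕-identityˡ (weight v u)) ⟩
    ∣ p ∣ʷ ⊕ weight v u                 ≈⟨ ⊕-comm ∣ p ∣ʷ (weight v u) ⟩
    weight v u ⊕ ∣ p ∣ʷ
      ≈⟨ ⊕-cong (wrap (proj₂ (weight-sym e)) , wrap (proj₁ (weight-sym e))) ≃-refl ⟩
    weight u v ⊕ ∣ p ∣ʷ                 ∎

  -- Uniqueness of tree paths equates vertex lists, not walks, which also carry adjacency proofs.
  -- Length is therefore expressed through the list alone.
  lengthᵛ : List (Fin m) → ℝ
  lengthᵛ []             = 0ᴿ
  lengthᵛ (x ∷ [])       = 0ᴿ
  lengthᵛ (x ∷ y ∷ xs)   = weight x y ⊕ lengthᵛ (y ∷ xs)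

  length≡lengthᵛ : ∀ {u v} (p : Walk graph u v) → ∣ p ∣ʷ ≡ lengthᵛ (vertices graph p)
  length≡lengthᵛ []                          = refl
  length≡lengthᵛ (_∷_ {u} {v} e [])          = refl
  length≡lengthᵛ (_∷_ {u} {v} e p@(_ ∷ _))   = cong (weight u v ⊕_) (length≡lengthᵛ p)

  -- Loop erasure: shorten the tail first, then cut the loop that the new first vertex may close. As
  -- weights are non-negative, cutting never lengthens the walk.
  shortcut : ∀ {u v} (p : Walk graph u v) →
             Σ[ q ∈ Walk graph u v ]
               IsPath graph q × vertices graph q ⊆ vertices graph p × ∣ q ∣ʷ ≲ ∣ p ∣ʷ
  shortcut []                = [] , [] ∷ [] , id , ≲-refl
  shortcut (_∷_ {u} {v} e p) with q , q-isPath , q⊆p , ∣q∣≲∣p∣ ← shortcut p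
    with u ∈? vertices graph q
  ... | no u∉q =
      e ∷ q
    , ∷-isPath e q u∉q q-isPath
    , (λ { (here x≡u) → here x≡u ; (there x∈q) → there (q⊆p x∈q) })
    , ⊕-mono ≲-refl ∣q∣≲∣p∣
  -- The closed walk made of `e` and `q₁` is discarded.
  ... | yes u∈q with q₁ , q₂ , refl ← split q u∈q =
      q₂
    , suffix-isPath q₁ q₂ q-isPath
    , there ∘ q⊆p ∘ ∈-++ʷ⁺ʳ q₁ q₂
    , (begin
      ∣ q₂ ∣ʷ                ≈⟨ ⊕-identityˡ ∣ q₂ ∣ʷ ⟨
      0ᴿ ⊕ ∣ q₂ ∣ʷ          ≲⟨ ⊕-mono (length-≥0 q₁) ≲-refl ⟩
      ∣ q₁ ∣ʷ ⊕ ∣ q₂ ∣ʷ     ≈⟨ length-++ʷ q₁ q₂ ⟨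
      ∣ q₁ ++ʷ q₂ ∣ʷ         ≲⟨ ∣q∣≲∣p∣ ⟩
      ∣ p ∣ʷ                 ≈⟨ ⊕-identityˡ ∣ p ∣ʷ ⟨
      0ᴿ ⊕ ∣ p ∣ʷ           ≲⟨ ⊕-mono (wrap (weight-≥0 e)) ≲-refl ⟩
      weight u v ⊕ ∣ p ∣ʷ   ∎)

  -- Betweenness and distance on tree paths

  infix 4 _∈[_,_]

  _∈[_,_] : Fin m → Fin m → Fin m → Set
  x ∈[ u , v ] = x ∈ vertices graph (path u v)

  left∈ : ∀ u v → u ∈[ u , v ]
  left∈ u v = head∈ (path u v)

  -- By uniqueness the shortcut of a walk is the tree path itself. The betweenness lemmas below use
  -- this by exhibiting a suitable walk.
  path⊆walk : ∀ {u v x} (p : Walk graph u v) → x ∈[ u , v ] → x ∈ vertices graph p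
  path⊆walk {u} {v} p x∈ =
    let q , q-isPath , q⊆p , _ = shortcut p
    in q⊆p (subst (_ ∈_) (unique (path u v) q (isPath u v) q-isPath) x∈)

  dist≲length : ∀ {u v} (p : Walk graph u v) → dist u v ≲ ∣ p ∣ʷ
  dist≲length {u} {v} p =
    let q , q-isPath , _ , ∣q∣≲∣p∣ = shortcut p
    in begin
      dist u v                          ≡⟨ length≡∣ path u v ∣ʷ ⟩
      ∣ path u v ∣ʷ                     ≡⟨ length≡lengthᵛ (path u v) ⟩
      lengthᵛ (vertices graph (path u v))
        ≡⟨ cong lengthᵛ (unique (path u v) q (isPath u v) q-isPath) ⟩
      lengthᵛ (vertices graph q)        ≡⟨ length≡lengthᵛ q ⟨
      ∣ q ∣ʷ                            ≲⟨ ∣q∣≲∣p∣ ⟩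
      ∣ p ∣ʷ                            ∎

  dist-sym : ∀ u v → dist u v ≃ dist v u
  dist-sym u v = ≲-sym u v , ≲-sym v u
    where
    ≲-sym : ∀ u v → dist u v ≲ dist v u
    ≲-sym u v = begin
      dist u v                      ≲⟨ dist≲length (reverseʷ (path v u)) ⟩
      ∣ reverseʷ (path v u) ∣ʷ      ≈⟨ length-reverseʷ (path v u) ⟩
      ∣ path v u ∣ʷ                 ≡⟨ length≡∣ path v u ∣ʷ ⟨
      dist v u                      ∎

  dist-triangle : ∀ u x v → dist u v ≲ dist u x ⊕ dist x v
  dist-triangle u x v = begin
    dist u v                   ≲⟨ dist≲length (path u x ++ʷ path x v) ⟩
    ∣ path u x ++ʷ path x v ∣ʷ ≈⟨ length-++ʷ (path u x) (path x v) ⟩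
    ∣ path u x ∣ʷ ⊕ ∣ path x v ∣ʷ
      ≡⟨ cong₂ _⊕_ length≡∣ path u x ∣ʷ length≡∣ path x v ∣ʷ ⟨
    dist u x ⊕ dist x v       ∎

  -- One half is the triangle inequality. For the other, the path splits at `x` into walks whose
  -- lengths bound the two distances from above.
  dist-via : ∀ {u x v} → x ∈[ u , v ] → dist u v ≃ dist u x ⊕ dist x v
  dist-via {u} {x} {v} x∈ =
    let q , r , path≡q++r = split (path u v) x∈
    in dist-triangle u x v , (begin
      dist u x ⊕ dist x v   ≲⟨ ⊕-mono (dist≲length q) (dist≲length r) ⟩
      ∣ q ∣ʷ ⊕ ∣ r ∣ʷ       ≈⟨ length-++ʷ q r ⟨
      ∣ q ++ʷ r ∣ʷ           ≡⟨ cong ∣_∣ʷ path≡q++r ⟨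
      ∣ path u v ∣ʷ          ≡⟨ length≡∣ path u v ∣ʷ ⟨
      dist u v               ∎)

  ∈-sym : ∀ {u v x} → x ∈[ u , v ] → x ∈[ v , u ]
  ∈-sym {u} {v} x∈ = ∈-reverseʷ⁻ (path v u) (path⊆walk (reverseʷ (path v u)) x∈)

  ∈-detour : ∀ {u v x} w → x ∈[ u , v ] → x ∈[ u , w ] ⊎ x ∈[ w , v ]
  ∈-detour {u} {v} w x∈ =
    ∈-++ʷ⁻ (path u w) (path w v) (path⊆walk (path u w ++ʷ path w v) x∈)

  ∈-subpath : ∀ {u v x y} → x ∈[ u , v ] → y ∈[ x , v ] → y ∈[ u , v ]
  ∈-subpath {u} {v} x∈ y∈ =
    let q , r , path≡q++r = split (path u v) x∈
    in subst (λ p → _ ∈ vertices graph p) (sym path≡q++r) (∈-++ʷ⁺ʳ q r (path⊆walk r y∈))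

  -- If `y` is off the path from `x` to `z`, prefixing that path with `y` yields a path, hence the
  -- one from `y` to `z`, and it passes through `x`.
  edge-oriented : ∀ {x y} → x ~ y → ∀ z → y ∈[ x , z ] ⊎ x ∈[ y , z ]
  edge-oriented {x} {y} e z with y ∈? vertices graph (path x z)
  ... | yes y∈ = inj₁ y∈
  ... | no  y∉ = inj₂ (subst (x ∈_)
    (unique (~-sym e ∷ path x z) (path y z)
      (∷-isPath (~-sym e) (path x z) y∉ (isPath x z)) (isPath y z))
    (there (head∈ (path x z))))

  -- A step along [a,b] that leaves [a,c] has to start on [b,c].
  ∈-step : ∀ {a b v v′} c → v ~ v′ → v′ ∈[ a , b ] →
           v ∈[ a , c ] → ¬ (v ∈[ b , c ]) → v′ ∈[ a , c ]
  ∈-step c v~v′ v′∈ab v∈ac v∉bc with ∈-detour c v′∈ab | edge-oriented v~v′ c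
  ... | inj₁ v′∈ac | _          = v′∈ac
  -- A step towards `c` continues along [a,c]. A step away from `c` would leave `v` between `v′` and
  -- `c`, hence on [b,c].
  ... | inj₂ v′∈cb | inj₁ v′∈vc = ∈-subpath v∈ac v′∈vc
  ... | inj₂ v′∈cb | inj₂ v∈v′c = contradiction (∈-subpath (∈-sym v′∈cb) v∈v′c) v∉bc

  -- Finds a branching vertex of the four paths: follow [a,b] from `a`, staying on both [a,c] and
  -- [a,d], and stop at the first vertex on [b,c] or [b,d]. Until then `∈-step` preserves the
  -- invariant, and `b` itself stops the search.
  crossing : ∀ a b c d → ∃[ x ] x ∈[ a , b ] ×
             (x ∈[ a , c ] × x ∈[ b , d ] ⊎ x ∈[ a , d ] × x ∈[ b , c ])
  crossing a b c d = go (path a b) id (left∈ a c) (left∈ a d)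
    where
    go : ∀ {v} (p : Walk graph v b) → (∀ {x} → x ∈ vertices graph p → x ∈[ a , b ]) →
         v ∈[ a , c ] → v ∈[ a , d ] →
         ∃[ x ] x ∈[ a , b ] ×
           (x ∈[ a , c ] × x ∈[ b , d ] ⊎ x ∈[ a , d ] × x ∈[ b , c ])
    go {v} [] p⊆ v∈ac v∈ad = v , p⊆ (here refl) , inj₁ (v∈ac , left∈ b d)
    go {v} (e ∷ p) p⊆ v∈ac v∈ad
      with v ∈? vertices graph (path b c) | v ∈? vertices graph (path b d)
    ... | yes v∈bc | _        = v , p⊆ (here refl) , inj₂ (v∈ad , v∈bc)
    ... | no  _    | yes v∈bd = v , p⊆ (here refl) , inj₁ (v∈ac , v∈bd)
    ... | no  v∉bc | no  v∉bd =
      go p (p⊆ ∘ there) (∈-step c e v′∈ab v∈ac v∉bc) (∈-step d e v′∈ab v∈ad v∉bd)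
      where v′∈ab = p⊆ (there (head∈ p))

  -- The triangle inequality at `x` bounds the left side by the four distances to `x`. Regrouped,
  -- these add up exactly to the right side, because `x` lies on [a,c] and [b,d].
  crossing-≲ : ∀ {a b c d x} → x ∈[ a , b ] → x ∈[ a , c ] → x ∈[ b , d ] →
               dist a b ⊕ dist c d ≲ dist a c ⊕ dist b d
  crossing-≲ {a} {b} {c} {d} {x} x∈ab x∈ac x∈bd = begin
    dist a b ⊕ dist c d
      ≲⟨ ⊕-mono (dist-triangle a x b) (dist-triangle c x d) ⟩
    (dist a x ⊕ dist x b) ⊕ (dist c x ⊕ dist x d)
      ≈⟨ ⊕-interchange (dist a x) (dist x b) (dist c x) (dist x d) ⟩
    (dist a x ⊕ dist c x) ⊕ (dist x b ⊕ dist x d)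
      ≈⟨ ⊕-cong (⊕-cong ≃-refl (dist-sym c x))
                 (⊕-cong (dist-sym x b) ≃-refl) ⟩
    (dist a x ⊕ dist x c) ⊕ (dist b x ⊕ dist x d)
      ≈⟨ ⊕-cong (dist-via x∈ac) (dist-via x∈bd) ⟨
    dist a c ⊕ dist b d ∎

  -- The alternative comes from `crossing`, which only tests membership of vertices, so no reals
  -- have to be compared.
  four-point : ∀ a b c d →
    dist a b ⊕ dist c d ≲ dist a c ⊕ dist b d ⊎
    dist a b ⊕ dist c d ≲ dist a d ⊕ dist b c
  four-point a b c d with crossing a b c d
  ... | x , x∈ab , inj₁ (x∈ac , x∈bd) = inj₁ (crossing-≲ x∈ab x∈ac x∈bd)
  ... | x , x∈ab , inj₂ (x∈ad , x∈bc) = inj₂ (begin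
    dist a b ⊕ dist c d  ≈⟨ ⊕-cong ≃-refl (dist-sym c d) ⟩
    dist a b ⊕ dist d c  ≲⟨ crossing-≲ x∈ab x∈ad x∈bc ⟩
    dist a d ⊕ dist b c  ∎)

-- The join of two copies of 2K₂ is not a PCG

module _ {n} (G : Graph n) where
  open Graph G

  -- `α i x` is endpoint `x` of edge `i`. Distinctness is listed separately, since a vertex is also
  -- nonadjacent to itself.
  Induced2K₂ : (Fin 2 → Fin 2 → Fin n) → Set
  Induced2K₂ α = (∀ i → α i 0F ~ α i 1F) ×
                 (∀ x y → α 0F x ≢ α 1F y × ¬ (α 0F x ~ α 1F y))

  induced2K₂? : ∀ α → Dec (Induced2K₂ α)
  induced2K₂? α = all? (λ i → α i 0F ~? α i 1F) ×-dec
    all? (λ x → all? λ y → ¬? (α 0F x ≟ α 1F y) ×-dec ¬? (α 0F x ~? α 1F y))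

module PCGProperties {n} {G : Graph n} (pcg : PCG G) where
  open Graph G
  open PCG pcg
  open WeightedTree tree using (dist)
  open TreeProperties tree using (four-point)

  d : Fin n → Fin n → ℝ
  d u v = dist (leaf u) (leaf v)

  edge⇒≢ : ∀ {u v} → u ~ v → u ≢ v
  edge⇒≢ u~v u≡v = ~-irrefl u≡v u~v

  edge-≳ : ∀ {u v} → u ~ v → dmin ≲ d u v
  edge-≳ u~v = wrap (proj₁ (to (adjacent _ _ (edge⇒≢ u~v)) u~v))

  edge-≲ : ∀ {u v} → u ~ v → d u v ≲ dmax
  edge-≲ u~v = wrap (proj₂ (to (adjacent _ _ (edge⇒≢ u~v)) u~v))

  Large : Fin n → Fin n → Set
  Large u v = ¬ (d u v ≲ dmax)

  -- The conclusion is a negation, so the doubly negated `d u v ≲ dmax` can be used as if it held.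
  small : ∀ {u v} → u ≢ v → ¬ (u ~ v) → ¬ Large u v → ¬ (dmin ≲ d u v)
  small u≢v u≁v ¬large dmin≲d = ¬large λ d≲dmax →
    u≁v (from (adjacent _ _ u≢v) (unwrap dmin≲d , unwrap d≲dmax))

  not-both-large : ∀ {p q r s} → p ~ r → q ~ s → p ~ s → q ~ r →
                   Large p q → ¬ Large r s
  not-both-large {p} {q} {r} {s} p~r q~s p~s q~r pq-large rs-large
    with four-point (leaf p) (leaf q) (leaf r) (leaf s)
  ... | inj₁ pq+rs≲pr+qs =
    u,v≴z⇒u+v≴z+z pq-large rs-large (edge-≲ p~r) (edge-≲ q~s) pq+rs≲pr+qs
  ... | inj₂ pq+rs≲ps+qr =
    u,v≴z⇒u+v≴z+z pq-large rs-large (edge-≲ p~s) (edge-≲ q~r) pq+rs≲ps+qr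

  not-all-small : ∀ α → Induced2K₂ G α → ¬ (∀ x y → ¬ Large (α 0F x) (α 1F y))
  not-all-small α (edges , nonedges) ¬large =
    -- The two edges form one pairing of the four vertices. Both other pairings consist of
    -- nonadjacent, hence small, pairs.
    Sum.[ u,v≵z⇒u+v≵z+z (α-small 0F 0F) (α-small 1F 1F) (edge-≳ (edges 0F)) (edge-≳ (edges 1F))
        , u,v≵z⇒u+v≵z+z (α-small 0F 1F) (α-small 1F 0F) (edge-≳ (edges 0F)) (edge-≳ (edges 1F))
        ] (four-point (leaf (α 0F 0F)) (leaf (α 0F 1F)) (leaf (α 1F 0F)) (leaf (α 1F 1F)))
    where
    α-small : ∀ x y → ¬ (dmin ≲ d (α 0F x) (α 1F y))
    α-small x y = small (proj₁ (nonedges x y)) (proj₂ (nonedges x y)) (¬large x y)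

module _ {n} {G : Graph n} where
  open Graph G

  2K₂∨2K₂⇒¬PCG : ∀ α β → Induced2K₂ G α → Induced2K₂ G β →
                 (∀ i x j y → α i x ~ β j y) → ¬ PCG G
  2K₂∨2K₂⇒¬PCG α β α-2K₂ β-2K₂ join pcg =
    -- As the goal is absurdity, refuting that all pairs are non-large amounts to being handed a
    -- large pair, here one in each copy.
    not-all-small α α-2K₂ λ x y α-large →
    not-all-small β β-2K₂ λ z w β-large →
    not-both-large (join 0F x 0F z) (join 1F y 1F w) (join 0F x 1F w) (join 1F y 0F z)
      α-large β-large
    where open PCGProperties pcg

-- The doubled 4-cycle

next : Fin 4 → Fin 4
next 0F = 1F
next 1F = 2F
next 2F = 3F
next 3F = 0F

Opposite : Fin 4 → Fin 4 → Set
Opposite i j = j ≡ next (next i)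

opposite? : ∀ i j → Dec (Opposite i j)
opposite? i j = j ≟ next (next i)

opposite-sym : ∀ {i j} → Opposite i j → Opposite j i
opposite-sym {i} {j} =
  from-yes (all? λ i → all? λ j → opposite? i j →-dec opposite? j i) i j

-- The twins on side i are 2i and 2i + 1.
side : Fin 8 → Fin 4
side = quotient 2

-- Twins are adjacent because no side is opposite to itself. Thus sides 0 and 2 carry one 2K₂, sides
-- 1 and 3 the other.
doubledC₄ : Graph 8
doubledC₄ = record
  { _~_      = λ u v → u ≢ v × ¬ Opposite (side u) (side v)
  ; ~-sym    = λ (u≢v , ¬opp) → ≢-sym u≢v , ¬opp ∘ opposite-sym
  ; ~-irrefl = λ u≡v (u≢v , _) → u≢v u≡v
  ; _~?_     = λ u v → ¬? (u ≟ v) ×-dec ¬? (opposite? (side u) (side v))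
  }

doubledC₄-¬PCG : ¬ PCG doubledC₄
doubledC₄-¬PCG = 2K₂∨2K₂⇒¬PCG (twins 0F) (twins 1F)
  (from-yes (induced2K₂? doubledC₄ (twins 0F)))
  (from-yes (induced2K₂? doubledC₄ (twins 1F)))
  (from-yes (all? λ i → all? λ x → all? λ j → all? λ y → twins 0F i x ~? twins 1F j y))
  where
  open Graph doubledC₄
  -- The sides 0, 2 for k = 0 and 1, 3 for k = 1.
  twins : Fin 2 → Fin 2 → Fin 2 → Fin 8
  twins k i x = combine (combine {2} {2} i k) x

-- Shared by the three models: twins receive the same set, and `corner i` is a point where set `i`
-- meets set `next i`.
module _ {P : Set} (T : Fin 4 → Pred P 0ℓ) (corner : Fin 4 → P)
  (corner∈ : ∀ i → T i (corner i)) (corner∈next : ∀ i → T (next i) (corner i))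
  (disjoint₀₂ : ¬ (T 0F ≬ T 2F)) (disjoint₁₃ : ¬ (T 1F ≬ T 3F)) where

  close : ∀ i j → ¬ Opposite i j → i ≡ j ⊎ j ≡ next i ⊎ i ≡ next j
  close = from-yes (all? λ i → all? λ j → ¬? (opposite? i j) →-dec
    (i ≟ j ⊎-dec (j ≟ next i ⊎-dec i ≟ next j)))

  meets : ∀ i j → ¬ Opposite i j → T i ≬ T j
  meets i j ¬opp with close i j ¬opp
  ... | inj₁ refl        = corner i , corner∈ i , corner∈ i
  ... | inj₂ (inj₁ refl) = corner i , corner∈ i , corner∈next i
  ... | inj₂ (inj₂ refl) = corner j , corner∈next j , corner∈ j

  disjoint : ∀ i j → Opposite i j → ¬ (T i ≬ T j)
  disjoint 0F _ refl = disjoint₀₂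
  disjoint 1F _ refl = disjoint₁₃
  disjoint 2F _ refl (x , x∈T₂ , x∈T₀) = disjoint₀₂ (x , x∈T₀ , x∈T₂)
  disjoint 3F _ refl (x , x∈T₃ , x∈T₁) = disjoint₁₃ (x , x∈T₁ , x∈T₃)

  doubledC₄-isIntersectionGraph : IsIntersectionGraph doubledC₄ (T ∘ side)
  doubledC₄-isIntersectionGraph u v u≢v = mk⇔
    (λ (_ , ¬opp) → meets (side u) (side v) ¬opp)
    (λ Tu≬Tv → u≢v , λ opp → disjoint (side u) (side v) opp Tu≬Tv)

-- Intersection models

square-≥0 : ∀ p → 0ℚ ℚ.≤ p ℚ.* p
square-≥0 p with ℚₚ.≤-total 0ℚ p
... | inj₁ 0≤p = ℚₚ.nonNegative⁻¹ _ {{ℚₚ.nonNeg*nonNeg⇒nonNeg p p}}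
  where instance _ = ℚ.nonNegative 0≤p
... | inj₂ p≤0 = ℚₚ.nonNegative⁻¹ _ {{ℚₚ.nonPos*nonPos⇒nonPos p p}}
  where instance _ = ℚ.nonPositive p≤0

2ℚ 3ℚ 4ℚ 10ℚ : ℚ
2ℚ = + 2 ℚ./ 1
3ℚ = + 3 ℚ./ 1
4ℚ = + 4 ℚ./ 1
10ℚ = + 10 ℚ./ 1

-- (p - 4)² + (p + 4)² = 2p² + 32 > 20, where 10 is the squared radius 9 plus
-- the slack 1 at which _≤ᴿ_ is evaluated.
not-near-both : ∀ p → (p ℚ.- 4ℚ) ℚ.* (p ℚ.- 4ℚ) ℚ.≤ 10ℚ →
                ¬ ((p ℚ.- (ℚ.- 4ℚ)) ℚ.* (p ℚ.- (ℚ.- 4ℚ)) ℚ.≤ 10ℚ)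
not-near-both p p≈4 p≈-4 = from-no (16+16 ℚₚ.≤? 10ℚ ℚ.+ 10ℚ) (begin
  16+16                                 ≡⟨ ℚₚ.+-identityʳ 16+16 ⟨
  16+16 ℚ.+ 0ℚ
    ≤⟨ ℚₚ.+-monoʳ-≤ 16+16 (ℚₚ.+-mono-≤ (square-≥0 p) (square-≥0 p)) ⟩
  16+16 ℚ.+ (p ℚ.* p ℚ.+ p ℚ.* p)
    ≡⟨ solve 2 (λ p c → (c :* c :+ c :* c) :+ (p :* p :+ p :* p) :=
         (p :- c) :* (p :- c) :+ (p :- (:- c)) :* (p :- (:- c))) refl p 4ℚ ⟩
  (p ℚ.- 4ℚ) ℚ.* (p ℚ.- 4ℚ) ℚ.+ (p ℚ.- (ℚ.- 4ℚ)) ℚ.* (p ℚ.- (ℚ.- 4ℚ))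
    ≤⟨ ℚₚ.+-mono-≤ p≈4 p≈-4 ⟩
  10ℚ ℚ.+ 10ℚ                           ∎)
  where
  open ℚₚ.≤-Reasoning
  16+16 : ℚ
  16+16 = 4ℚ ℚ.* 4ℚ ℚ.+ 4ℚ ℚ.* 4ℚ

-- With radius 3, each corner lies at squared distance 8 from the centres of its two disks, within
-- 9, while opposite centres are 8 apart, beyond 6.
disk-centre disk-corner : Fin 4 → ℚ × ℚ
disk-centre 0F = 4ℚ , 0ℚ
disk-centre 1F = 0ℚ , 4ℚ
disk-centre 2F = ℚ.- 4ℚ , 0ℚ
disk-centre 3F = 0ℚ , ℚ.- 4ℚ

disk-corner 0F = 2ℚ , 2ℚ
disk-corner 1F = ℚ.- 2ℚ , 2ℚ
disk-corner 2F = ℚ.- 2ℚ , ℚ.- 2ℚ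
disk-corner 3F = 2ℚ , ℚ.- 2ℚ

disk : Fin 4 → Disk
disk i = record
  { centre-x = fromℚ (proj₁ (disk-centre i))
  ; centre-y = fromℚ (proj₂ (disk-centre i))
  ; radius   = fromℚ 3ℚ
  ; radius>0 = fromℚ-mono-< (from-yes (0ℚ ℚₚ.<? 3ℚ))
  }

doubledC₄-isDiskGraph : IsDiskGraph doubledC₄
doubledC₄-isDiskGraph =
  (λ u → disk (side u)) , doubledC₄-isIntersectionGraph (λ i → ⟦ disk i ⟧ᴰ)
  (λ i → fromℚ (proj₁ (disk-corner i)) , fromℚ (proj₂ (disk-corner i)))
  (λ i → unwrap (fromℚ-mono (from-yes (all? λ i → inside? i i) i)))
  (λ i → unwrap (fromℚ-mono (from-yes (all? λ i → inside? i (next i)) i)))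
  (λ ((x , y) , p , q) →
    let N , p′ = p 1ℚ 0<1ℚ
        M , q′ = q 1ℚ 0<1ℚ
        n = N ℕ.⊔ M
    in not-near-both (seq x n)
      (drop-right (seq x n ℚ.- 4ℚ) (seq y n ℚ.- 0ℚ) (p′ n (ℕₚ.m≤m⊔n N M)))
      (drop-right (seq x n ℚ.- (ℚ.- 4ℚ)) (seq y n ℚ.- 0ℚ) (q′ n (ℕₚ.m≤n⊔m N M))))
  (λ ((x , y) , p , q) →
    let N , p′ = p 1ℚ 0<1ℚ
        M , q′ = q 1ℚ 0<1ℚ
        n = N ℕ.⊔ M
    in not-near-both (seq y n)
      (drop-left (seq x n ℚ.- 0ℚ) (seq y n ℚ.- 4ℚ) (p′ n (ℕₚ.m≤m⊔n N M)))
      (drop-left (seq x n ℚ.- 0ℚ) (seq y n ℚ.- (ℚ.- 4ℚ)) (q′ n (ℕₚ.m≤n⊔m N M))))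
  where
  sqdist : ℚ × ℚ → ℚ × ℚ → ℚ
  sqdist (x , y) (a , b) = (x ℚ.- a) ℚ.* (x ℚ.- a) ℚ.+ (y ℚ.- b) ℚ.* (y ℚ.- b)

  inside? : ∀ i j → Dec (sqdist (disk-corner i) (disk-centre j) ℚ.≤ 3ℚ ℚ.* 3ℚ)
  inside? i j = sqdist (disk-corner i) (disk-centre j) ℚₚ.≤? 3ℚ ℚ.* 3ℚ

  drop-right : ∀ a b {c} → a ℚ.* a ℚ.+ b ℚ.* b ℚ.≤ c → a ℚ.* a ℚ.≤ c
  drop-right a b {c} a²+b²≤c = begin
    a ℚ.* a             ≡⟨ ℚₚ.+-identityʳ (a ℚ.* a) ⟨
    a ℚ.* a ℚ.+ 0ℚ      ≤⟨ ℚₚ.+-monoʳ-≤ (a ℚ.* a) (square-≥0 b) ⟩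
    a ℚ.* a ℚ.+ b ℚ.* b ≤⟨ a²+b²≤c ⟩
    c                   ∎
    where open ℚₚ.≤-Reasoning

  drop-left : ∀ a b {c} → a ℚ.* a ℚ.+ b ℚ.* b ℚ.≤ c → b ℚ.* b ℚ.≤ c
  drop-left a b {c} a²+b²≤c =
    drop-right b a (subst (ℚ._≤ c) (ℚₚ.+-comm (a ℚ.* a) (b ℚ.* b)) a²+b²≤c)

-- Segments: the sides of the unit square, counterclockwise from the bottom

0<1 : 0ᴿ <ᴿ 1ᴿ
0<1 = fromℚ-mono-< 0<1ℚ

segment : Fin 4 → Segment
segment 0F = horizontal 0ᴿ 1ᴿ 0ᴿ 0<1
segment 1F = vertical 1ᴿ 0ᴿ 1ᴿ 0<1
segment 2F = horizontal 0ᴿ 1ᴿ 1ᴿ 0<1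
segment 3F = vertical 0ᴿ 0ᴿ 1ᴿ 0<1

doubledC₄-isGridIntersectionGraph : IsGridIntersectionGraph doubledC₄
doubledC₄-isGridIntersectionGraph =
  (λ u → segment (side u)) , doubledC₄-isIntersectionGraph (λ i → ⟦ segment i ⟧ˢ) corner
  (λ { 0F → (0≤1 , 1≤1) , 0≈0 ; 1F → 1≈1 , (0≤1 , 1≤1)
     ; 2F → (0≤0 , 0≤1) , 1≈1 ; 3F → 0≈0 , (0≤0 , 0≤1) })
  (λ { 0F → 1≈1 , (0≤0 , 0≤1) ; 1F → (0≤1 , 1≤1) , 1≈1
     ; 2F → 0≈0 , (0≤1 , 1≤1) ; 3F → (0≤0 , 0≤1) , 0≈0 })
  (λ ((x , y) , (_ , y≈0) , (_ , y≈1)) → separated {y} y≈0 y≈1)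
  (λ ((x , y) , (x≈1 , _) , (x≈0 , _)) → separated {x} x≈0 x≈1)
  where
  corner : Fin 4 → ℝ²
  corner 0F = 1ᴿ , 0ᴿ
  corner 1F = 1ᴿ , 1ᴿ
  corner 2F = 0ᴿ , 1ᴿ
  corner 3F = 0ᴿ , 0ᴿ

  0≤0 : 0ᴿ ≤ᴿ 0ᴿ
  0≤0 = unwrap (≲-refl {0ᴿ})
  1≤1 : 1ᴿ ≤ᴿ 1ᴿ
  1≤1 = unwrap (≲-refl {1ᴿ})
  0≤1 : 0ᴿ ≤ᴿ 1ᴿ
  0≤1 = unwrap (fromℚ-mono (ℚₚ.<⇒≤ 0<1ℚ))
  0≈0 : 0ᴿ ≈ᴿ 0ᴿ
  0≈0 = 0≤0 , 0≤0
  1≈1 : 1ᴿ ≈ᴿ 1ᴿ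
  1≈1 = 1≤1 , 1≤1

  separated : ∀ {z} → z ≈ᴿ 0ᴿ → ¬ (z ≈ᴿ 1ᴿ)
  separated {z} (z≤0 , _) (_ , 1≤z) =
    <⇒≴ {0ᴿ} {1ᴿ} 0<1 (≲-trans {1ᴿ} {z} {0ᴿ} (wrap 1≤z) (wrap z≤0))

-- Arcs: the quarters of the circle

/1-mono-≤ : ∀ {i j} → i ℤ.≤ j → i ℚ./ 1 ℚ.≤ j ℚ./ 1
/1-mono-≤ {i} {j} i≤j = ℚₚ.toℚᵘ-cancel-≤ (begin
  ℚ.toℚᵘ (i ℚ./ 1)    ≃⟨ ℚₚ.toℚᵘ-fromℚᵘ (mkℚᵘ i 0) ⟩
  mkℚᵘ i 0            ≤⟨ *≤* (ℤₚ.*-monoʳ-≤-nonNeg 1ℤ i≤j) ⟩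
  mkℚᵘ j 0            ≃⟨ ℚₚ.toℚᵘ-fromℚᵘ (mkℚᵘ j 0) ⟨
  ℚ.toℚᵘ (j ℚ./ 1)    ∎)
  where open ℚᵘₚ.≤-Reasoning

/1-homo-suc : ∀ i → ℤ.suc i ℚ./ 1 ≡ i ℚ./ 1 ℚ.+ 1ℚ
/1-homo-suc i = ℚₚ.toℚᵘ-injective (begin
  ℚ.toℚᵘ (ℤ.suc i ℚ./ 1)           ≈⟨ ℚₚ.toℚᵘ-fromℚᵘ (mkℚᵘ (ℤ.suc i) 0) ⟩
  mkℚᵘ (ℤ.suc i) 0                 ≈⟨ *≡* (cong (ℤ._* 1ℤ) lemma) ⟩
  mkℚᵘ i 0 ℚᵘ.+ ℚᵘ.1ℚᵘ             ≈⟨ ℚᵘₚ.+-congˡ ℚᵘ.1ℚᵘ (ℚₚ.toℚᵘ-fromℚᵘ (mkℚᵘ i 0)) ⟨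
  ℚ.toℚᵘ (i ℚ./ 1) ℚᵘ.+ ℚᵘ.1ℚᵘ     ≈⟨ ℚₚ.toℚᵘ-homo-+ (i ℚ./ 1) 1ℚ ⟨
  ℚ.toℚᵘ (i ℚ./ 1 ℚ.+ 1ℚ)          ∎)
  where
  open import Relation.Binary.Reasoning.Setoid ℚᵘₚ.≃-setoid
  lemma : 1ℤ ℤ.+ i ≡ i ℤ.* 1ℤ ℤ.+ 1ℤ
  lemma = trans (ℤₚ.+-comm 1ℤ i) (cong (ℤ._+ 1ℤ) (sym (ℤₚ.*-identityʳ i)))

opaque
  unfolding _⊕_

  -- Arc membership is phrased with `+ᴿ`; this and the next lemma carry it over to the opaque sum.
  ⊕-wrapʳ : ∀ x y z → x ≤ᴿ y +ᴿ z → x ≲ y ⊕ z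
  ⊕-wrapʳ x y z = wrap

  ⊕-wrapˡ : ∀ x y z → x +ᴿ y ≤ᴿ z → x ⊕ y ≲ z
  ⊕-wrapˡ x y z = wrap

  shift-mono : ∀ t {k l} → k ℤ.≤ l → t ⊕ fromℤ k ≲ t ⊕ fromℤ l
  shift-mono t k≤l = pointwise-≲ λ n → ℚₚ.+-monoʳ-≤ (seq t n) (/1-mono-≤ k≤l)

  shift-suc : ∀ s t k → s ≲ t ⊕ fromℤ k → s ⊕ 1ᴿ ≲ t ⊕ fromℤ (ℤ.suc k)
  shift-suc s t k s≲t+k = wrap λ ε 0<ε →
    let N , p = unwrap s≲t+k ε 0<ε
    in N , λ n hn → begin
      seq s n ℚ.+ 1ℚ                              ≤⟨ ℚₚ.+-monoˡ-≤ 1ℚ (p n hn) ⟩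
      ((seq t n ℚ.+ k ℚ./ 1) ℚ.+ ε) ℚ.+ 1ℚ
        ≡⟨ solve 4 (λ t k e o → ((t :+ k) :+ e) :+ o := (t :+ (k :+ o)) :+ e) refl
             (seq t n) (k ℚ./ 1) ε 1ℚ ⟩
      (seq t n ℚ.+ (k ℚ./ 1 ℚ.+ 1ℚ)) ℚ.+ ε
        ≡⟨ cong (λ q → (seq t n ℚ.+ q) ℚ.+ ε) (/1-homo-suc k) ⟨
      (seq t n ℚ.+ ℤ.suc k ℚ./ 1) ℚ.+ ε           ∎
    where open ℚₚ.≤-Reasoning

  <⇒≴⊕ : ∀ x y z → x <ᴿ y +ᴿ z → ¬ (y ⊕ z ≲ x)
  <⇒≴⊕ x y z = <⇒≴ {x} {y +ᴿ z}

module _ (A B : Arc) where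
  private
    module A = Arc A
    module B = Arc B

  -- A common point has lifts `t + k` in `A` and `t + l` in `B`. If `l ≤ k`, then `B` starts no
  -- later than `A` ends. Otherwise `l` is at least `k + 1`, and `B` reaches the start of `A` one
  -- turn later.
  disjoint-arcs : A.end <ᴿ B.start → B.end <ᴿ A.start +ᴿ 1ᴿ → ¬ (⟦ A ⟧ᴬ ≬ ⟦ B ⟧ᴬ)
  disjoint-arcs A<B B<A+1 (t , (k , a≤t+k , t+k≤a′) , (l , b≤t+l , t+l≤b′))
    with l ℤₚ.≤? k
  ... | yes l≤k = <⇒≴ {A.end} {B.start} A<B (begin
    B.start           ≲⟨ ⊕-wrapʳ B.start t (fromℤ l) b≤t+l ⟩
    t ⊕ fromℤ l       ≲⟨ shift-mono t l≤k ⟩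
    t ⊕ fromℤ k       ≲⟨ ⊕-wrapˡ t (fromℤ k) A.end t+k≤a′ ⟩
    A.end             ∎)
    where open ≲-Reasoning
  ... | no l≰k = <⇒≴⊕ B.end A.start 1ᴿ B<A+1 (begin
    A.start ⊕ 1ᴿ            ≲⟨ shift-suc A.start t k (⊕-wrapʳ A.start t (fromℤ k) a≤t+k) ⟩
    t ⊕ fromℤ (ℤ.suc k)     ≲⟨ shift-mono t (ℤₚ.i<j⇒suc[i]≤j (ℤₚ.≰⇒> l≰k)) ⟩
    t ⊕ fromℤ l             ≲⟨ ⊕-wrapˡ t (fromℤ l) B.end t+l≤b′ ⟩
    B.end                   ∎)
    where open ≲-Reasoning

quarter : ℕ → ℚ
quarter j = + j ℚ./ 4

arc : Fin 4 → Arc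
arc i = record
  { start       = fromℚ (quarter (toℕ i))
  ; end         = fromℚ (quarter (suc (toℕ i)))
  ; start<end   = fromℚ-mono-< {quarter (toℕ i)} {quarter (suc (toℕ i))} (start<end i)
  ; end<start+1 = fromℚ-mono-< {quarter (suc (toℕ i))} {quarter (toℕ i) ℚ.+ 1ℚ} (end<start+1 i)
  }
  where
  start<end : ∀ (i : Fin 4) → quarter (toℕ i) ℚ.< quarter (suc (toℕ i))
  start<end = from-yes (all? {4} λ i → quarter (toℕ i) ℚₚ.<? quarter (suc (toℕ i)))

  end<start+1 : ∀ (i : Fin 4) → quarter (suc (toℕ i)) ℚ.< quarter (toℕ i) ℚ.+ 1ℚ
  end<start+1 = from-yes (all? {4} λ i → quarter (suc (toℕ i)) ℚₚ.<? quarter (toℕ i) ℚ.+ 1ℚ)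

doubledC₄-isCircularArcGraph : IsCircularArcGraph doubledC₄
doubledC₄-isCircularArcGraph =
  (λ u → arc (side u)) , doubledC₄-isIntersectionGraph (λ i → ⟦ arc i ⟧ᴬ)
  -- The corner is the end of arc `i`, which is the start of the next arc up to a whole turn.
  (λ i → fromℚ (quarter (suc (toℕ i))))
  (λ i → 0ℤ , endpoint∈ i 0ℤ i (from-yes (all? λ i → contains? i 0ℤ i) i))
  (λ i → turn i , endpoint∈ i (turn i) (next i)
    (from-yes (all? λ i → contains? i (turn i) (next i)) i))
  (disjoint-arcs (arc 0F) (arc 2F)
    (fromℚ-mono-< {quarter 1} {quarter 2} (from-yes (quarter 1 ℚₚ.<? quarter 2)))
    (fromℚ-mono-< {quarter 3} {quarter 0 ℚ.+ 1ℚ}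
      (from-yes (quarter 3 ℚₚ.<? quarter 0 ℚ.+ 1ℚ))))
  (disjoint-arcs (arc 1F) (arc 3F)
    (fromℚ-mono-< {quarter 2} {quarter 3} (from-yes (quarter 2 ℚₚ.<? quarter 3)))
    (fromℚ-mono-< {quarter 4} {quarter 1 ℚ.+ 1ℚ}
      (from-yes (quarter 4 ℚₚ.<? quarter 1 ℚ.+ 1ℚ))))
  where
  -- The last arc ends at 1, which is the point 0 of the circle.
  turn : Fin 4 → ℤ
  turn 3F = -1ℤ
  turn _  = 0ℤ

  endpoint : Fin 4 → ℤ → ℚ
  endpoint i k = quarter (suc (toℕ i)) ℚ.+ k ℚ./ 1

  Contains : Fin 4 → ℤ → Fin 4 → Set
  Contains i k j = quarter (toℕ j) ℚ.≤ endpoint i k × endpoint i k ℚ.≤ quarter (suc (toℕ j))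

  contains? : ∀ i k j → Dec (Contains i k j)
  contains? i k j =
    (quarter (toℕ j) ℚₚ.≤? endpoint i k) ×-dec (endpoint i k ℚₚ.≤? quarter (suc (toℕ j)))

  endpoint∈ : ∀ i k j → Contains i k j →
    Arc.start (arc j) ≤ᴿ fromℚ (quarter (suc (toℕ i))) +ᴿ fromℤ k ×
    fromℚ (quarter (suc (toℕ i))) +ᴿ fromℤ k ≤ᴿ Arc.end (arc j)
  endpoint∈ i k j (start≤ , ≤end) =
      unwrap (fromℚ-mono {quarter (toℕ j)} {endpoint i k} start≤)
    , unwrap (fromℚ-mono {endpoint i k} {quarter (suc (toℕ j))} ≤end)

theorem1 : (∃[ n ] ∃[ G ] IsDiskGraph {n} G × ¬ PCG G)
    × (∃[ n ] ∃[ G ] IsGridIntersectionGraph {n} G × ¬ PCG G)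
    × (∃[ n ] ∃[ G ] IsCircularArcGraph {n} G × ¬ PCG G)
theorem1 =
    (8 , doubledC₄ , doubledC₄-isDiskGraph             , doubledC₄-¬PCG)
  , (8 , doubledC₄ , doubledC₄-isGridIntersectionGraph , doubledC₄-¬PCG)
  , (8 , doubledC₄ , doubledC₄-isCircularArcGraph      , doubledC₄-¬PCG)
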